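{- If $G$ is a subcubic graph (i.e., a finite simple graph of maximum degree at most $3$), then \[ \nu_{ur}(G) \geq \frac{n(G) - c(G)}{2} - \frac{m(G)}{6}. \]
   Context: All graphs are simple, finite and undirected. A matching in $G$ is a set of pairwise non-adjacent edges. A matching $M$ in $G$ is uniquely restricted if no other matching in $G$ covers exactly the same set of vertices as $M$. $\nu_{ur}(G)$ denotes the maximum size of a uniquely restricted matching in $G$. $n(G)$, $m(G)$ and $c(G)$ denote the number of vertices, the number of edges, and the number of connected components of $G$, respectively. -}

module Defs where

open import Data.Nat using (ℕ; zero; suc; _+_; _*_; _/_; _<_; _≤_)
open import Data.Bool using (Bool; true; false; if_then_else_; _∧_)
open import Data.Fin using (Fin; toℕ)
open import Data.List using (List; map; allFin)
open import Data.Nat.ListAction using (sum)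
open import Data.Maybe using (Maybe; just; nothing; is-just)
open import Data.Nat using (_<ᵇ_)
open import Relation.Binary.PropositionalEquality using (_≡_)
open import Data.Product using (∃)

count : ∀ {n} → (Fin n → Bool) → ℕ
count {n} p = sum (map (λ i → if p i then 1 else 0) (allFin n))

record Graph (n : ℕ) : Set where
  field
    adj     : Fin n → Fin n → Bool
    symmetric   : ∀ u v → adj u v ≡ adj v u
    irreflexive : ∀ u → adj u u ≡ false
open Graph public

degree : ∀ {n} → Graph n → Fin n → ℕ
degree G u = count (λ v → adj G u v)

Subcubic : ∀ {n} → Graph n → Set
Subcubic {n} G = ∀ u → degree G u ≤ 3

edgeCount : ∀ {n} → Graph n → ℕ
edgeCount G = sum (map (λ i → count (λ j → (toℕ i <ᵇ toℕ j) ∧ adj G i j)) (allFin _))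

data Connected {n} (G : Graph n) : Fin n → Fin n → Set where
  here : ∀ {u} → Connected G u u
  step : ∀ {u w v} → adj G u w ≡ true → Connected G w v → Connected G u v

record HasComponents {n} (G : Graph n) (c : ℕ) : Set where
  field
    comp       : Fin n → Fin c
    surjective : ∀ (k : Fin c) → ∃ λ u → comp u ≡ k
    sound      : ∀ u v → comp u ≡ comp v → Connected G u v
    complete   : ∀ u v → Connected G u v → comp u ≡ comp v

-- a matching, represented by its (partial) mate function: mate u ≡ just v
-- iff uv is an edge of the matching.  This representation is canonical:
-- matchings (sets of pairwise disjoint edges) correspond bijectively to such maps.
record Matching {n} (G : Graph n) : Set where
  field
    mate      : Fin n → Maybe (Fin n)
    mate-edge : ∀ u v → mate u ≡ just v → adj G u v ≡ true
    mate-sym  : ∀ u v → mate u ≡ just v → mate v ≡ just u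
open Matching public

covered : ∀ {n} {G : Graph n} → Matching G → Fin n → Bool
covered M u = is-just (mate M u)

size : ∀ {n} {G : Graph n} → Matching G → ℕ
size M = count (covered M) / 2

UniquelyRestricted : ∀ {n} {G : Graph n} → Matching G → Set
UniquelyRestricted {n} {G} M =
  ∀ (M′ : Matching G) → (∀ u → covered M′ u ≡ covered M u) → ∀ u → mate M′ u ≡ mate M u

{-# OPTIONS --safe #-}
module Submission where

-- Induct over induced subgraphs G[S], proving 3|S| ≤ 6|M| + e(S) + 3|R| for every set R
-- meeting all components of G[S]. Two operations drive the induction: a vertex may be deleted,
-- and if u has a neighbour v, then uv extends any uniquely restricted matching of G[S] − N[u].
-- A vertex of degree 0 and a non-cut vertex of degree 3 can be deleted without loss, and a
-- leaf can be matched to its neighbour. Otherwise choose a vertex x and a component K of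
-- G[S] − x that is minimal under inclusion: K contains no cut vertices, so all of its vertices
-- have degree 2 and, if K is taken adjacent to x, K ∪ {x} spans a cycle. If this cycle is a triangle,
-- remove it; if not, remove three consecutive vertices of K, starting at a neighbour of x. In
-- both cases the middle vertex is matched, at least three edges disappear, and no new component
-- arises.

open import Defs
open import Data.Nat using (ℕ; _+_; _*_; _≤_)
open import Data.Product using (∃; _×_)
import Algebra.Properties.CommutativeMonoid.Sum
open import Data.Bool using (Bool; true; false; if_then_else_; _∧_)
import Data.Bool.Properties as Bool
open import Data.Empty using (⊥-elim)
open import Data.Fin using (Fin; zero; suc; toℕ)
open import Data.Fin.Properties using (_≟_; any?; toℕ-injective)
open import Data.List using (List; []; _∷_; _++_; length; map; tabulate; allFin)
open import Data.List.Membership.Propositional using () renaming (_∈_ to _∈ₗ_)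
open import Data.List.Membership.Propositional.Properties using (∈-++⁺ˡ; ∈-++⁺ʳ; ∈-tabulate⁺)
open import Data.List.Properties using (map-tabulate; length-++; length-tabulate)
open import Data.List.Relation.Unary.Any using (here; there)
open import Data.Maybe using (Maybe; just; nothing; is-just)
open import Data.Maybe.Properties using (just-injective)
open import Data.Nat using (zero; suc; _<_; _<ᵇ_; z≤n; s≤s; _≤?_; _/_)
open import Data.Nat.DivMod using (m*n/n≡m)
import Data.Nat.ListAction as List
open import Data.Nat.Properties hiding (_≟_; _≤?_)
open import Data.Nat.Tactic.RingSolver using (solve-∀)
open import Data.Product using (_,_; proj₁; proj₂; -,_)
open import Data.Sum using (_⊎_; inj₁; inj₂; swap)
open import Function using (_∘_; id)
open import Relation.Binary.Definitions using (tri<; tri≈; tri>)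
open import Relation.Binary.PropositionalEquality
  using (_≡_; _≢_; _≗_; refl; sym; trans; cong; cong₂; subst₂; module ≡-Reasoning)
open import Relation.Nullary using (¬_; Dec; yes; no; does)
open import Relation.Nullary.Decidable using (_×-dec_; ¬?; map′; decidable-stable)

open Algebra.Properties.CommutativeMonoid.Sum +-0-commutativeMonoid
  using (sum; sum-cong-≗; sum-replicate-zero; ∑-distrib-+; ∑-comm)

-- Finite sums and counting

𝟙 : Bool → ℕ
𝟙 b = if b then 1 else 0

sum-allFin : ∀ {n} (f : Fin n → ℕ) → List.sum (map f (allFin n)) ≡ sum f
sum-allFin f = trans (cong List.sum (map-tabulate id f)) (sum-tabulate f)
  where
  sum-tabulate : ∀ {n} (f : Fin n → ℕ) → List.sum (tabulate f) ≡ sum f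
  sum-tabulate {zero}  f = refl
  sum-tabulate {suc n} f = cong (f zero +_) (sum-tabulate (f ∘ suc))

sum-mono : ∀ {n} {f g : Fin n → ℕ} → (∀ i → f i ≤ g i) → sum f ≤ sum g
sum-mono {zero}  f≤g = z≤n
sum-mono {suc n} f≤g = +-mono-≤ (f≤g zero) (sum-mono (f≤g ∘ suc))

sum-δ : ∀ {n} (v : Fin n) (f : Fin n → ℕ) →
        sum (λ i → if does (i ≟ v) then f i else 0) ≡ f v
sum-δ {suc n} zero    f = trans (cong (f zero +_) (sum-replicate-zero n)) (+-identityʳ _)
sum-δ {suc n} (suc v) f = sum-δ v (f ∘ suc)

-- Vertex sets as Boolean predicates, and their cardinalities.

infix  4 _∈_ _⊆_
infixl 7 _∖_

-- A record rather than a synonym, so that i and S can be inferred from a proof.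
record _∈_ {n} (i : Fin n) (S : Fin n → Bool) : Set where
  constructor ⟨_⟩
  field holds : S i ≡ true
open _∈_

_⊆_ : ∀ {n} → (Fin n → Bool) → (Fin n → Bool) → Set
S ⊆ T = ∀ i → i ∈ S → i ∈ T

_∖_ : ∀ {n} → (Fin n → Bool) → Fin n → (Fin n → Bool)
(S ∖ v) i = if does (i ≟ v) then false else S i

true≢false : ∀ {b} → b ≡ true → b ≢ false
true≢false refl ()

module _ {n : ℕ} where

  infix 4 _∈?_

  _∈?_ : ∀ v (S : Fin n → Bool) → Dec (v ∈ S)
  v ∈? S = map′ ⟨_⟩ holds (S v Bool.≟ true)

  ∈-∖⁺ : ∀ {S : Fin n → Bool} {v i} → i ≢ v → i ∈ S → i ∈ S ∖ v
  ∈-∖⁺ {S} {v} {i} i≢v ⟨ i∈S ⟩ = ⟨ lemma ⟩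
    where
    lemma : (S ∖ v) i ≡ true
    lemma with i ≟ v
    ... | yes i≡v = ⊥-elim (i≢v i≡v)
    ... | no  _   = i∈S

  ∈-∖⁻ : ∀ {S : Fin n → Bool} {v i} → i ∈ S ∖ v → i ≢ v × i ∈ S
  ∈-∖⁻ {S} {v} {i} ⟨ i∈ ⟩ = lemma i∈
    where
    lemma : (S ∖ v) i ≡ true → i ≢ v × i ∈ S
    lemma i∈ with i ≟ v
    ... | no i≢v = i≢v , ⟨ i∈ ⟩

  ∖-⊆ : ∀ {S : Fin n → Bool} {v} → S ∖ v ⊆ S
  ∖-⊆ i = proj₂ ∘ ∈-∖⁻

  ∉-∖ : ∀ {S : Fin n → Bool} {v} → ¬ v ∈ S ∖ v
  ∉-∖ v∈ = proj₁ (∈-∖⁻ v∈) refl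

  ∖-removed : ∀ {S : Fin n → Bool} {v i} → i ∈ S → ¬ i ∈ S ∖ v → i ≡ v
  ∖-removed {v = v} {i} i∈S i∉ = decidable-stable (i ≟ v) λ i≢v → i∉ (∈-∖⁺ i≢v i∈S)

  count≡sum : ∀ (p : Fin n → Bool) → count p ≡ sum (𝟙 ∘ p)
  count≡sum p = sum-allFin (𝟙 ∘ p)

  count-cong : ∀ {p q : Fin n → Bool} → p ≗ q → count p ≡ count q
  count-cong {p} {q} p≗q =
    trans (count≡sum p) (trans (sum-cong-≗ (cong 𝟙 ∘ p≗q)) (sym (count≡sum q)))

  count-mono : ∀ {p q : Fin n → Bool} → p ⊆ q → count p ≤ count q
  count-mono {p} {q} p⊆q =
    subst₂ _≤_ (sym (count≡sum p)) (sym (count≡sum q)) (sum-mono λ i → 𝟙-mono (holds ∘ p⊆q i ∘ ⟨_⟩))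
    where
    𝟙-mono : ∀ {a b} → (a ≡ true → b ≡ true) → 𝟙 a ≤ 𝟙 b
    𝟙-mono {false} _ = z≤n
    𝟙-mono {true}  h rewrite h refl = ≤-refl

  count-∖ : ∀ (p : Fin n → Bool) {v} → v ∈ p → count p ≡ suc (count (p ∖ v))
  count-∖ p {v} v∈p = begin
    count p                                ≡⟨ count≡sum p ⟩
    sum (𝟙 ∘ p)                            ≡⟨ sum-cong-≗ split ⟩
    sum (λ i → δ i + 𝟙 ((p ∖ v) i))        ≡⟨ ∑-distrib-+ δ _ ⟩
    sum δ + sum (𝟙 ∘ (p ∖ v))              ≡⟨ cong₂ _+_ (sum-δ v (λ _ → 1)) (sym (count≡sum (p ∖ v))) ⟩
    suc (count (p ∖ v))                    ∎
    where
    open ≡-Reasoning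
    δ : Fin n → ℕ
    δ i = if does (i ≟ v) then 1 else 0
    split : ∀ i → 𝟙 (p i) ≡ δ i + 𝟙 ((p ∖ v) i)
    split i with i ≟ v
    ... | yes refl = cong 𝟙 (holds v∈p)
    ... | no  _    = refl

  count-pos : ∀ {p : Fin n → Bool} {v} → v ∈ p → 1 ≤ count p
  count-pos {p} v∈p rewrite count-∖ p v∈p = s≤s z≤n

  count-∖-< : ∀ {p : Fin n → Bool} {v} → v ∈ p → count (p ∖ v) < count p
  count-∖-< {p} v∈p = ≤-reflexive (sym (count-∖ p v∈p))

  count-∅ : ∀ {p : Fin n → Bool} → (∀ v → ¬ v ∈ p) → count p ≡ 0
  count-∅ {p} p∅ = trans (count≡sum p)
    (trans (sum-cong-≗ λ i → cong 𝟙 (Bool.¬-not (p∅ i ∘ ⟨_⟩))) (sum-replicate-zero n))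

  count≡0⇒∅ : ∀ {p : Fin n → Bool} → count p ≡ 0 → ∀ v → ¬ v ∈ p
  count≡0⇒∅ {p} c≡0 v v∈p with () ← trans (sym c≡0) (count-∖ p v∈p)

  count-suc : ∀ (p : Fin n → Bool) {k} → count p ≡ suc k → ∃ λ v → v ∈ p × count (p ∖ v) ≡ k
  count-suc p c≡ with any? (_∈? p)
  ... | yes (v , v∈p) = v , v∈p , suc-injective (trans (sym (count-∖ p v∈p)) c≡)
  ... | no ∄v with () ← trans (sym c≡) (count-∅ λ v v∈p → ∄v (v , v∈p))

  count≡1⇒! : ∀ (p : Fin n → Bool) → count p ≡ 1 → ∃ λ v → v ∈ p × (∀ w → w ∈ p → w ≡ v)
  count≡1⇒! p c≡ with count-suc p c≡
  ... | v , v∈p , c′≡ = v , v∈p , λ w w∈p →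
    decidable-stable (w ≟ v) λ w≢v → count≡0⇒∅ c′≡ w (∈-∖⁺ w≢v w∈p)

  -- The extra vertex is a default witness: if `p` is empty, the uniqueness claim holds vacuously
  -- for it.
  count≤1⇒! : ∀ (p : Fin n → Bool) → Fin n → count p ≤ 1 → ∃ λ v → ∀ w → w ∈ p → w ≡ v
  count≤1⇒! p d c≤1 with m≤n⇒m<n∨m≡n c≤1
  ... | inj₁ c<1 = d , λ w w∈p → ⊥-elim (<⇒≱ c<1 (count-pos w∈p))
  ... | inj₂ c≡1 with count≡1⇒! p c≡1
  ...   | v , _ , v! = v , v!

  count≡2⇒other : ∀ (p : Fin n → Bool) {a} → count p ≡ 2 → a ∈ p →
                  ∃ λ b → b ≢ a × b ∈ p × (∀ w → w ∈ p → w ≡ a ⊎ w ≡ b)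
  count≡2⇒other p {a} c≡ a∈p
    with count≡1⇒! (p ∖ a) (suc-injective (trans (sym (count-∖ p a∈p)) c≡))
  ... | b , b∈ , b! = b , proj₁ (∈-∖⁻ b∈) , proj₂ (∈-∖⁻ b∈) , a-or-b
    where
    a-or-b : ∀ w → w ∈ p → w ≡ a ⊎ w ≡ b
    a-or-b w w∈p with w ≟ a
    ... | yes w≡a = inj₁ w≡a
    ... | no  w≢a = inj₂ (b! w (∈-∖⁺ w≢a w∈p))

  count-all : count {n} (λ _ → true) ≡ n
  count-all = trans (count≡sum (λ _ → true)) (sum-ones n)
    where
    sum-ones : ∀ m → sum {m} (λ _ → 1) ≡ m
    sum-ones zero    = refl
    sum-ones (suc m) = cong suc (sum-ones m)

  -- Turns a neighbourhood into a list of roots whose length is exactly the degree.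
  enumerate : ∀ (p : Fin n → Bool) → ∃ λ L → length L ≡ count p × (∀ v → v ∈ p → v ∈ₗ L)
  enumerate p = go (count p) p refl
    where
    go : ∀ k p → count p ≡ k → ∃ λ L → length L ≡ k × (∀ v → v ∈ p → v ∈ₗ L)
    go zero    p c≡ = [] , refl , λ v v∈p → ⊥-elim (count≡0⇒∅ c≡ v v∈p)
    go (suc k) p c≡ with count-suc p c≡
    ... | v , v∈p , c′≡ with go k (p ∖ v) c′≡
    ...   | L , |L| , L-all = v ∷ L , cong suc |L| , all
      where
      all : ∀ w → w ∈ p → w ∈ₗ v ∷ L
      all w w∈p with w ≟ v
      ... | yes w≡v = here w≡v
      ... | no  w≢v = there (L-all w (∈-∖⁺ w≢v w∈p))

module _ {n : ℕ} (G : Graph n) where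

  adj-sym : ∀ {u v} → adj G u v ≡ true → adj G v u ≡ true
  adj-sym {u} {v} uv = trans (symmetric G v u) uv

  adj-≢ : ∀ {u v} → adj G u v ≡ true → u ≢ v
  adj-≢ uv refl = true≢false uv (irreflexive G _)

  -- Degrees and edges of induced subgraphs

  nbrs : (Fin n → Bool) → Fin n → Fin n → Bool
  nbrs S v w = S w ∧ adj G v w

  deg : (Fin n → Bool) → Fin n → ℕ
  deg S v = count (nbrs S v)

  ∈-nbrs⁺ : ∀ {S v w} → w ∈ S → adj G v w ≡ true → w ∈ nbrs S v
  ∈-nbrs⁺ ⟨ w∈S ⟩ vw = ⟨ cong₂ _∧_ w∈S vw ⟩

  ∈-nbrs⁻ : ∀ {S v w} → w ∈ nbrs S v → w ∈ S × adj G v w ≡ true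
  ∈-nbrs⁻ {S} {v} {w} ⟨ w∈ ⟩ = lemma (S w) refl w∈
    where
    lemma : ∀ b → S w ≡ b → b ∧ adj G v w ≡ true → w ∈ S × adj G v w ≡ true
    lemma true w∈S vw = ⟨ w∈S ⟩ , vw

  deg≤degree : ∀ S v → deg S v ≤ degree G v
  deg≤degree S v = count-mono {p = nbrs S v} {q = adj G v} λ w → ⟨_⟩ ∘ proj₂ ∘ ∈-nbrs⁻

  deg-∖ : ∀ {S u v} → u ∈ S → adj G v u ≡ true → deg S v ≡ suc (deg (S ∖ u) v)
  deg-∖ {S} {u} {v} u∈S vu =
    trans (count-∖ (nbrs S v) (∈-nbrs⁺ u∈S vu)) (cong suc (count-cong same))
    where
    same : nbrs S v ∖ u ≗ nbrs (S ∖ u) v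
    same w with w ≟ u
    ... | yes _ = refl
    ... | no  _ = refl

  -- The order test counts each edge once. The tests on `S` precede `adj`, so that for the full
  -- vertex set the formula computes to the one in `edgeCount`.
  edge : (Fin n → Bool) → Fin n → Fin n → Bool
  edge S i j = (toℕ i <ᵇ toℕ j) ∧ (S i ∧ (S j ∧ adj G i j))

  edges : (Fin n → Bool) → ℕ
  edges S = sum λ i → sum λ j → 𝟙 (edge S i j)

  edges-all : edges (λ _ → true) ≡ edgeCount G
  edges-all = sym (trans (sum-allFin (λ i → count (λ j → (toℕ i <ᵇ toℕ j) ∧ adj G i j)))
                         (sum-cong-≗ λ i → count≡sum (λ j → (toℕ i <ᵇ toℕ j) ∧ adj G i j)))

  -- In the table of pairs i < j, the edges at `v` fill row `v` (`above`) and column `v` (`below`),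
  -- and what remains is the table of `S ∖ v`. Every neighbour of `v` is counted in the row or in
  -- the column, since there are no loops.
  edges-∖ : ∀ {S v} → v ∈ S → deg S v + edges (S ∖ v) ≤ edges S
  edges-∖ {S} {v} v∈S = begin
    deg S v + edges (S ∖ v)
      ≡⟨ cong (_+ edges (S ∖ v)) (count≡sum (nbrs S v)) ⟩
    sum (𝟙 ∘ nbrs S v) + edges (S ∖ v)
      ≤⟨ +-monoˡ-≤ (edges (S ∖ v)) (sum-mono above-or-below) ⟩
    sum (λ j → above j + below j) + edges (S ∖ v)
      ≡⟨ cong (_+ edges (S ∖ v)) (∑-distrib-+ above below) ⟩
    (sum above + sum below) + edges (S ∖ v)
      ≡⟨ cong (_+ edges (S ∖ v)) (cong₂ _+_ row column) ⟩
    (sum (λ i → sum (δ₁ i)) + sum (λ i → sum (δ₂ i))) + edges (S ∖ v)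
      ≡⟨ cong (_+ edges (S ∖ v)) (∑-distrib-+ (λ i → sum (δ₁ i)) (λ i → sum (δ₂ i))) ⟨
    sum (λ i → sum (δ₁ i) + sum (δ₂ i)) + edges (S ∖ v)
      ≡⟨ ∑-distrib-+ (λ i → sum (δ₁ i) + sum (δ₂ i)) _ ⟨
    sum (λ i → (sum (δ₁ i) + sum (δ₂ i)) + sum (λ j → 𝟙 (edge (S ∖ v) i j)))
      ≡⟨ sum-cong-≗ (λ i → trans (∑-distrib-+ (λ j → δ₁ i j + δ₂ i j) _)
                                  (cong (_+ sum (λ j → 𝟙 (edge (S ∖ v) i j))) (∑-distrib-+ (δ₁ i) (δ₂ i)))) ⟨
    sum (λ i → sum (λ j → (δ₁ i j + δ₂ i j) + 𝟙 (edge (S ∖ v) i j)))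
      ≡⟨ sum-cong-≗ (λ i → sum-cong-≗ (split i)) ⟨
    edges S ∎
    where
    open ≤-Reasoning
    above below : Fin n → ℕ
    above j = 𝟙 ((toℕ v <ᵇ toℕ j) ∧ (S j ∧ adj G v j))
    below i = 𝟙 ((toℕ i <ᵇ toℕ v) ∧ (S i ∧ adj G v i))
    δ₁ δ₂ : Fin n → Fin n → ℕ
    δ₁ i j = if does (i ≟ v) then above j else 0
    δ₂ i j = if does (j ≟ v) then below i else 0

    <ᵇ-true : ∀ {a b} → a < b → (a <ᵇ b) ≡ true
    <ᵇ-true {a} {b} a<b with a <ᵇ b | <⇒<ᵇ a<b
    ... | true | _ = refl

    <ᵇ-irrefl : ∀ a → (a <ᵇ a) ≡ false
    <ᵇ-irrefl zero    = refl
    <ᵇ-irrefl (suc a) = <ᵇ-irrefl a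

    above-or-below : ∀ j → 𝟙 (nbrs S v j) ≤ above j + below j
    above-or-below j with <-cmp (toℕ v) (toℕ j)
    ... | tri< v<j _ _ rewrite <ᵇ-true v<j = m≤m+n _ _
    ... | tri> _ _ j<v rewrite <ᵇ-true j<v = m≤n+m _ _
    ... | tri≈ _ v≡j _ with toℕ-injective v≡j
    ...   | refl rewrite irreflexive G v | Bool.∧-zeroʳ (S v) = z≤n

    row : sum above ≡ sum (λ i → sum (δ₁ i))
    row = sym (trans (∑-comm δ₁) (sum-cong-≗ λ j → sum-δ v (λ _ → above j)))

    column : sum below ≡ sum (λ i → sum (δ₂ i))
    column = sym (sum-cong-≗ λ i → sum-δ v (λ _ → below i))

    split : ∀ i j → 𝟙 (edge S i j) ≡ (δ₁ i j + δ₂ i j) + 𝟙 (edge (S ∖ v) i j)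
    split i j with i ≟ v | j ≟ v
    ... | yes refl | yes refl rewrite <ᵇ-irrefl (toℕ i) = refl
    ... | yes refl | no _ rewrite holds v∈S | Bool.∧-zeroʳ (toℕ i <ᵇ toℕ j)
        = sym (trans (+-identityʳ _) (+-identityʳ _))
    ... | no _ | yes refl
        rewrite holds v∈S | Bool.∧-zeroʳ (S i) | Bool.∧-zeroʳ (toℕ i <ᵇ toℕ j) | symmetric G i v
        = sym (+-identityʳ _)
    ... | no _ | no _ = refl

  -- Reachability inside an induced subgraph

  data Reach (S : Fin n → Bool) : Fin n → Fin n → Set where
    stop : ∀ {u} → u ∈ S → Reach S u u
    step : ∀ {u w v} → u ∈ S → adj G u w ≡ true → Reach S w v → Reach S u v

  source : ∀ {S u v} → Reach S u v → u ∈ S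
  source (stop u∈S)     = u∈S
  source (step u∈S _ _) = u∈S

  target : ∀ {S u v} → Reach S u v → v ∈ S
  target (stop u∈S)   = u∈S
  target (step _ _ p) = target p

  Reach-trans : ∀ {S u v w} → Reach S u v → Reach S v w → Reach S u w
  Reach-trans (stop _)        q = q
  Reach-trans (step u∈S uw p) q = step u∈S uw (Reach-trans p q)

  Reach-sym : ∀ {S u v} → Reach S u v → Reach S v u
  Reach-sym (stop u∈S)      = stop u∈S
  Reach-sym (step u∈S uw p) =
    Reach-trans (Reach-sym p) (step (source p) (adj-sym uw) (stop u∈S))

  Reach-mono : ∀ {S T u v} → S ⊆ T → Reach S u v → Reach T u v
  Reach-mono S⊆T (stop u∈S)      = stop (S⊆T _ u∈S)
  Reach-mono S⊆T (step u∈S uw p) = step (S⊆T _ u∈S) uw (Reach-mono S⊆T p)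

  -- A path through `x` would have an initial segment from `w` to `x`.
  avoid : ∀ {S w v x} → ¬ Reach S w x → Reach S w v → Reach (S ∖ x) w v
  avoid ¬wx (stop w∈S) = stop (∈-∖⁺ (λ { refl → ¬wx (stop w∈S) }) w∈S)
  avoid ¬wx (step w∈S wt p) =
    step (∈-∖⁺ (λ { refl → ¬wx (stop w∈S) }) w∈S) wt (avoid (¬wx ∘ step w∈S wt) p)

  -- Cut the path at its last visit to `u`; the part after it avoids `u`.
  last-exit : ∀ {S u w v} → u ≢ v → Reach S w v →
              Reach (S ∖ u) w v ⊎ ∃ λ t → adj G u t ≡ true × Reach (S ∖ u) t v
  last-exit u≢v (stop w∈S) = inj₁ (stop (∈-∖⁺ (u≢v ∘ sym) w∈S))
  last-exit {u = u} {w} u≢v (step w∈S wt p) with last-exit u≢v p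
  ... | inj₂ exit = inj₂ exit
  ... | inj₁ q with w ≟ u
  ...   | yes refl = inj₂ (-, wt , q)
  ...   | no  w≢u  = inj₁ (step (∈-∖⁺ w≢u w∈S) wt q)

  -- By `last-exit`, a path from `u` can be chosen never to return to `u`, so the search continues
  -- in `S ∖ u` and the size of the set decreases. Deciding reachability is what allows the later
  -- search for cut vertices.
  reach? : ∀ S u v → Dec (Reach S u v)
  reach? S = go (count S) S refl
    where
    go : ∀ k S → count S ≡ k → ∀ u v → Dec (Reach S u v)
    go k S c≡ u v with u ∈? S
    ... | no u∉S = no (u∉S ∘ source)
    go zero    S c≡ u v | yes u∈S = ⊥-elim (count≡0⇒∅ c≡ u u∈S)
    go (suc k) S c≡ u v | yes u∈S with u ≟ v
    ... | yes refl = yes (stop u∈S)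
    ... | no  u≢v  = map′ to from (any? λ w → (adj G u w Bool.≟ true) ×-dec go k (S ∖ u) c′≡ w v)
      where
      c′≡ = suc-injective (trans (sym (count-∖ S u∈S)) c≡)
      to : (∃ λ w → adj G u w ≡ true × Reach (S ∖ u) w v) → Reach S u v
      to (w , uw , p) = step u∈S uw (Reach-mono ∖-⊆ p)
      from : Reach S u v → ∃ λ w → adj G u w ≡ true × Reach (S ∖ u) w v
      from (stop _) = ⊥-elim (u≢v refl)
      from (step _ uw p) with last-exit u≢v p
      ... | inj₁ q    = -, uw , q
      ... | inj₂ exit = exit

  -- Dominating lists of roots.

  -- A list R dominates S if it meets every component of G[S]; its length then bounds the
  -- number of components from above.
  Dominates : (Fin n → Bool) → List (Fin n) → Set
  Dominates S R = ∀ s → s ∈ S → ∃ λ r → r ∈ₗ R × Reach S s r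

  -- O meets every component of G[S′] that is adjacent to the removed part S − S′.
  Frontier : (S S′ : Fin n → Bool) → List (Fin n) → Set
  Frontier S S′ O = ∀ {s t} → s ∈ S′ → t ∈ S → ¬ t ∈ S′ → adj G s t ≡ true →
                    ∃ λ o → o ∈ₗ O × Reach S′ s o

  -- R′ drops a single occurrence of `r`; further occurrences may stay in R′, so the two
  -- alternatives can overlap.
  ∈ₗ-split : ∀ {r : Fin n} {R} → r ∈ₗ R →
             ∃ λ R′ → length R ≡ suc (length R′) × (∀ {t} → t ∈ₗ R → t ≡ r ⊎ t ∈ₗ R′)
  ∈ₗ-split {R = _ ∷ R} (here refl) = R , refl , λ { (here t≡r) → inj₁ t≡r ; (there t∈R) → inj₂ t∈R }
  ∈ₗ-split {r} {x ∷ R} (there r∈R) with ∈ₗ-split r∈R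
  ... | R′ , |R| , split = x ∷ R′ , cong suc |R| , split′
    where
    split′ : ∀ {t} → t ∈ₗ x ∷ R → t ≡ r ⊎ t ∈ₗ x ∷ R′
    split′ (here t≡x) = inj₂ (here t≡x)
    split′ (there t∈R) with split t∈R
    ... | inj₁ t≡r  = inj₁ t≡r
    ... | inj₂ t∈R′ = inj₂ (there t∈R′)

  -- The root r₀ of a removed vertex d is traded for O: a vertex that had reached r₀ could
  -- also reach d, so its path leaves S′ and passes the frontier.
  Dominates-shrink : ∀ {S S′ R O d} → d ∈ S → ¬ d ∈ S′ → S′ ⊆ S → Frontier S S′ O → Dominates S R →
                     ∃ λ R′ → suc (length R′) ≡ length R + length O × Dominates S′ R′
  Dominates-shrink {S} {S′} {R} {O} {d} d∈S d∉S′ S′⊆S front dom with dom d d∈S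
  ... | r₀ , r₀∈R , d→r₀ with ∈ₗ-split r₀∈R
  ...   | R₁ , |R| , split = O ++ R₁ , sizes , dom′
    where
    sizes : suc (length (O ++ R₁)) ≡ length R + length O
    sizes = begin
      suc (length (O ++ R₁))         ≡⟨ cong suc (length-++ O) ⟩
      suc (length O + length R₁)     ≡⟨ cong suc (+-comm (length O) _) ⟩
      suc (length R₁) + length O     ≡⟨ cong (_+ length O) |R| ⟨
      length R + length O            ∎
      where open ≡-Reasoning

    -- Follow the path up to its first step out of S′: that step is an edge to a removed vertex,
    -- where the frontier supplies a root.
    leave : ∀ {s t} → s ∈ S′ → Reach S s t → Reach S′ s t ⊎ ∃ λ o → o ∈ₗ O × Reach S′ s o
    leave s∈S′ (stop _) = inj₁ (stop s∈S′)
    leave s∈S′ (step {w = w} _ sw p) with w ∈? S′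
    ... | no  w∉S′ = inj₂ (front s∈S′ (source p) w∉S′ sw)
    ... | yes w∈S′ with leave w∈S′ p
    ...   | inj₁ q             = inj₁ (step s∈S′ sw q)
    ...   | inj₂ (o , o∈O , q) = inj₂ (o , o∈O , step s∈S′ sw q)

    dom-via : ∀ {s r} → s ∈ S′ → Reach S s r → r ≡ r₀ ⊎ r ∈ₗ R₁ →
              ∃ λ r → r ∈ₗ O ++ R₁ × Reach S′ s r
    dom-via s∈S′ p (inj₁ refl) with leave s∈S′ (Reach-trans p (Reach-sym d→r₀))
    ... | inj₁ q             = ⊥-elim (d∉S′ (target q))
    ... | inj₂ (o , o∈O , q) = o , ∈-++⁺ˡ o∈O , q
    dom-via {r = r} s∈S′ p (inj₂ r∈R₁) with leave s∈S′ p
    ... | inj₁ q             = r , ∈-++⁺ʳ O r∈R₁ , q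
    ... | inj₂ (o , o∈O , q) = o , ∈-++⁺ˡ o∈O , q

    dom′ : Dominates S′ (O ++ R₁)
    dom′ s s∈S′ with dom s (S′⊆S s s∈S′)
    ... | r , r∈R , p = dom-via s∈S′ p (split r∈R)

  -- Matchings

  -- Serves both operations on mates: `nothing` at both ends deletes an edge, the opposite ends
  -- insert one.
  override : ∀ {A : Set} → (Fin n → A) → Fin n → A → Fin n → A → Fin n → A
  override f u x v y i = if does (i ≟ u) then x else if does (i ≟ v) then y else f i

  override-fst : ∀ {A : Set} (f : Fin n → A) u {x} v {y} → override f u x v y u ≡ x
  override-fst f u v with u ≟ u
  ... | yes _  = refl
  ... | no u≢u = ⊥-elim (u≢u refl)

  override-snd : ∀ {A : Set} (f : Fin n → A) {u x v y} → u ≢ v → override f u x v y v ≡ y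
  override-snd f {u} {v = v} u≢v with v ≟ u
  ... | yes v≡u = ⊥-elim (u≢v (sym v≡u))
  ... | no  _ with v ≟ v
  ...   | yes _  = refl
  ...   | no v≢v = ⊥-elim (v≢v refl)

  override-other : ∀ {A : Set} (f : Fin n → A) {u x v y i} → i ≢ u → i ≢ v →
                   override f u x v y i ≡ f i
  override-other f {u} {v = v} {i = i} i≢u i≢v with i ≟ u
  ... | yes i≡u = ⊥-elim (i≢u i≡u)
  ... | no  _ with i ≟ v
  ...   | yes i≡v = ⊥-elim (i≢v i≡v)
  ...   | no  _   = refl

  mate⇒covered : ∀ (M : Matching G) {u v} → mate M u ≡ just v → u ∈ covered M
  mate⇒covered M eq = ⟨ cong is-just eq ⟩

  covered⇒mate : ∀ (M : Matching G) {u} → u ∈ covered M → ∃ λ v → mate M u ≡ just v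
  covered⇒mate M {u} ⟨ c ⟩ with mate M u
  ... | just v = v , refl

  deleteEdge : ∀ (M : Matching G) {u v} → mate M u ≡ just v → Matching G
  deleteEdge M {u} {v} uv = record
    { mate      = mate⁻
    ; mate-edge = λ i j eq → mate-edge M i j (proj₂ (proj₂ (inside i eq)))
    ; mate-sym  = λ i j eq → let (i≢u , i≢v , ij) = inside i eq; ji = mate-sym M i j ij in
        -- The mate of `u` is `v` and conversely, while `i` is neither of them; hence `j`, the mate
        -- of `i`, is neither of them as well.
        trans (override-other (mate M)
                (λ { refl → i≢v (just-injective (trans (sym ji) uv)) })
                (λ { refl → i≢u (just-injective (trans (sym ji) (mate-sym M u v uv))) }))
              ji
    }
    where
    mate⁻ = override (mate M) u nothing v nothing
    inside : ∀ i {j} → mate⁻ i ≡ just j → i ≢ u × i ≢ v × mate M i ≡ just j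
    inside i eq with i ≟ u
    ... | no i≢u with i ≟ v
    ...   | no i≢v = i≢u , i≢v , eq

  module _ (M : Matching G) {u v : Fin n} (uv : adj G u v ≡ true)
           (u∉M : ¬ u ∈ covered M) (v∉M : ¬ v ∈ covered M) where

    private
      u≢v : u ≢ v
      u≢v = adj-≢ uv

      mate⁺ : Fin n → Maybe (Fin n)
      mate⁺ = override (mate M) u (just v) v (just u)

      -- Each case carries the value of `mate⁺`, so that the nested decisions inside `override` are
      -- resolved only once.
      data View (i : Fin n) : Set where
        isFst : i ≡ u → mate⁺ i ≡ just v → View i
        isSnd : i ≡ v → mate⁺ i ≡ just u → View i
        other : i ≢ u → i ≢ v → mate⁺ i ≡ mate M i → View i

      view : ∀ i → View i
      view i with i ≟ u | i ≟ v
      ... | yes refl | _        = isFst refl (override-fst (mate M) u v)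
      ... | no  _    | yes refl = isSnd refl (override-snd (mate M) u≢v)
      ... | no  i≢u  | no  i≢v  = other i≢u i≢v (override-other (mate M) i≢u i≢v)

    insertEdge : Matching G
    insertEdge = record { mate = mate⁺ ; mate-edge = edge⁺ ; mate-sym = sym⁺ }
      where
      edge⁺ : ∀ i j → mate⁺ i ≡ just j → adj G i j ≡ true
      edge⁺ i j eq with view i
      ... | isFst refl eq′ with refl ← just-injective (trans (sym eq) eq′) = uv
      ... | isSnd refl eq′ with refl ← just-injective (trans (sym eq) eq′) = adj-sym uv
      ... | other _ _ eq′ = mate-edge M i j (trans (sym eq′) eq)
      sym⁺ : ∀ i j → mate⁺ i ≡ just j → mate⁺ j ≡ just i
      sym⁺ i j eq with view i
      ... | isFst refl eq′ with refl ← just-injective (trans (sym eq) eq′) =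
        override-snd (mate M) u≢v
      ... | isSnd refl eq′ with refl ← just-injective (trans (sym eq) eq′) =
        override-fst (mate M) u v
      ... | other _ _ eq′ = trans (override-other (mate M)
              (λ { refl → u∉M (mate⇒covered M ji) }) (λ { refl → v∉M (mate⇒covered M ji) })) ji
        where ji = mate-sym M i j (trans (sym eq′) eq)

    insertEdge-covered : ∀ {i} → i ∈ covered insertEdge → i ≡ u ⊎ i ≡ v ⊎ i ∈ covered M
    insertEdge-covered {i} ⟨ c ⟩ with view i
    ... | isFst i≡u _ = inj₁ i≡u
    ... | isSnd i≡v _ = inj₂ (inj₁ i≡v)
    ... | other _ _ eq = inj₂ (inj₂ ⟨ trans (sym (cong is-just eq)) c ⟩)

    insertEdge-count : count (covered insertEdge) ≡ 2 + count (covered M)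
    insertEdge-count = begin
      count (covered insertEdge)                  ≡⟨ count-∖ (covered insertEdge) u∈ ⟩
      suc (count (covered insertEdge ∖ u))        ≡⟨ cong suc (count-∖ _ (∈-∖⁺ (u≢v ∘ sym) v∈)) ⟩
      2 + count (covered insertEdge ∖ u ∖ v)      ≡⟨ cong (2 +_) (count-cong same) ⟩
      2 + count (covered M)                       ∎
      where
      open ≡-Reasoning
      u∈ : u ∈ covered insertEdge
      u∈ = mate⇒covered insertEdge (override-fst (mate M) u v)
      v∈ : v ∈ covered insertEdge
      v∈ = mate⇒covered insertEdge (override-snd (mate M) u≢v)
      same : covered insertEdge ∖ u ∖ v ≗ covered M
      same i with i ≟ v | i ≟ u
      ... | yes refl | _        = sym (Bool.¬-not (v∉M ∘ ⟨_⟩))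
      ... | no  _    | yes refl = sym (Bool.¬-not (u∉M ∘ ⟨_⟩))
      ... | no  _    | no  _    = refl

    -- In the graph induced on the covered vertices u has v as its only neighbour, so u must
    -- be matched to v.
    insertEdge-unique : (∀ w → w ∈ covered M → ¬ adj G u w ≡ true) →
                        UniquelyRestricted M → UniquelyRestricted insertEdge
    insertEdge-unique isolated unique M′ same = agree
      where
      covered⁺ : ∀ {i} → i ∈ covered M′ → i ∈ covered insertEdge
      covered⁺ {i} ⟨ c ⟩ = ⟨ trans (sym (same i)) c ⟩

      mate-u : mate M′ u ≡ just v
      mate-u with covered⇒mate M′ {u} ⟨ trans (same u) (cong is-just (override-fst (mate M) u v)) ⟩
      ... | w , uw with insertEdge-covered (covered⁺ (mate⇒covered M′ (mate-sym M′ u w uw)))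
      ...   | inj₁ refl        = ⊥-elim (adj-≢ (mate-edge M′ u w uw) refl)
      ...   | inj₂ (inj₁ refl) = uw
      ...   | inj₂ (inj₂ w∈M)  = ⊥-elim (isolated w w∈M (mate-edge M′ u w uw))

      -- Without the edge uv, the competitor M′ covers exactly what `M` covers, so the uniqueness of
      -- `M` applies to it.
      rest-covered : ∀ i → covered (deleteEdge M′ mate-u) i ≡ covered M i
      rest-covered i with view i
      ... | isFst refl _ = trans (cong is-just (override-fst (mate M′) u v)) (sym (Bool.¬-not (u∉M ∘ ⟨_⟩)))
      ... | isSnd refl _ = trans (cong is-just (override-snd (mate M′) u≢v)) (sym (Bool.¬-not (v∉M ∘ ⟨_⟩)))
      ... | other i≢u i≢v eq = trans (cong is-just (override-other (mate M′) i≢u i≢v))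
                                     (trans (same i) (cong is-just eq))

      agree : ∀ i → mate M′ i ≡ mate⁺ i
      agree i with view i
      ... | isFst refl eq = trans mate-u (sym eq)
      ... | isSnd refl eq = trans (mate-sym M′ u v mate-u) (sym eq)
      ... | other i≢u i≢v eq = trans (sym (override-other (mate M′) i≢u i≢v))
                                     (trans (unique (deleteEdge M′ mate-u) rest-covered i) (sym eq))

  -- The reductions

  -- `bound` is the inequality of the theorem times 6, free of subtraction. `pairs` is the number of
  -- matching edges; storing it postpones the division in `size` to the very end.
  record Solution (S : Fin n → Bool) (c : ℕ) : Set where
    field
      matching : Matching G
      within   : covered matching ⊆ S
      unique   : UniquelyRestricted matching
      pairs    : ℕ
      count≡   : count (covered matching) ≡ pairs * 2
      bound    : 3 * count S ≤ 6 * pairs + edges S + 3 * c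

  -- Quantifying over all dominating lists lets the induction hypothesis be applied to whatever list
  -- a reduction produces, without computing components.
  Solvable : (Fin n → Bool) → Set
  Solvable S = ∀ R → Dominates S R → Solution S (length R)

  solveEmpty : ∀ {S} → (∀ v → ¬ v ∈ S) → Solvable S
  solveEmpty S∅ R _ = record
    { matching = record { mate = λ _ → nothing ; mate-edge = λ _ _ () ; mate-sym = λ _ _ () }
    ; within   = λ _ ()
    ; unique   = λ M′ same u → uncovered (mate M′ u) (same u)
    ; pairs    = 0
    ; count≡   = count-∅ {n} {p = λ _ → false} λ _ ()
    ; bound    = ≤-trans (≤-reflexive (cong (3 *_) (count-∅ S∅))) z≤n
    }
    where
    uncovered : ∀ (m : Maybe (Fin n)) → is-just m ≡ false → m ≡ nothing
    uncovered nothing _ = refl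

  -- The root given up by `Dominates-shrink` pays the 3 for the vertex `v`; the edges lost at `v`
  -- pay 3 for each new root in `O`.
  deleteVertex : ∀ {S v} O → v ∈ S → 3 * length O ≤ deg S v → Frontier S (S ∖ v) O →
                 Solvable (S ∖ v) → Solvable S
  deleteVertex {S} {v} O v∈S |O|≤ front solve R dom
    with Dominates-shrink v∈S (∉-∖ {S = S}) ∖-⊆ front dom
  ... | R′ , |R′| , dom′ = record
    { matching = matching ; within = λ i → ∖-⊆ i ∘ within i ; unique = unique
    ; pairs = pairs ; count≡ = count≡ ; bound = bound′ }
    where
    open Solution (solve R′ dom′)
    open ≤-Reasoning
    shuffle₁ : ∀ k e r → 3 + (6 * k + e + 3 * r) ≡ 6 * k + e + 3 * suc r
    shuffle₁ = solve-∀
    shuffle₂ : ∀ k e r o → 6 * k + e + 3 * (r + o) ≡ 6 * k + (3 * o + e) + 3 * r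
    shuffle₂ = solve-∀
    bound′ : 3 * count S ≤ 6 * pairs + edges S + 3 * length R
    bound′ = begin
      3 * count S                                               ≡⟨ cong (3 *_) (count-∖ S v∈S) ⟩
      3 * suc (count (S ∖ v))                                   ≡⟨ *-suc 3 (count (S ∖ v)) ⟩
      3 + 3 * count (S ∖ v)                                     ≤⟨ +-monoʳ-≤ 3 bound ⟩
      3 + (6 * pairs + edges (S ∖ v) + 3 * length R′)           ≡⟨ shuffle₁ pairs (edges (S ∖ v)) (length R′) ⟩
      6 * pairs + edges (S ∖ v) + 3 * suc (length R′)           ≡⟨ cong (λ r → 6 * pairs + edges (S ∖ v) + 3 * r) |R′| ⟩
      6 * pairs + edges (S ∖ v) + 3 * (length R + length O)     ≡⟨ shuffle₂ pairs (edges (S ∖ v)) (length R) (length O) ⟩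
      6 * pairs + (3 * length O + edges (S ∖ v)) + 3 * length R
        ≤⟨ +-monoˡ-≤ (3 * length R) (+-monoʳ-≤ (6 * pairs)
             (≤-trans (+-monoˡ-≤ (edges (S ∖ v)) |O|≤) (edges-∖ v∈S))) ⟩
      6 * pairs + edges S + 3 * length R                        ∎

  -- The 9 in the cost inequality is 6 for the new matching edge plus 3 for the root given up.
  -- Together with the lost edges it must pay for the removed vertices and the roots in `O`.
  -- Uniqueness survives because `u` has no neighbour in S′.
  matchEdge : ∀ {S S′ u v} O → S′ ⊆ S → u ∈ S → v ∈ S → ¬ u ∈ S′ → ¬ v ∈ S′ → adj G u v ≡ true →
              (∀ w → w ∈ S′ → ¬ adj G u w ≡ true) → Frontier S S′ O →
              3 * count S + (edges S′ + 3 * length O) ≤ 3 * count S′ + (edges S + 9) →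
              Solvable S′ → Solvable S
  matchEdge {S} {S′} {u} {v} O S′⊆S u∈S v∈S u∉S′ v∉S′ uv isolated front cost solve R dom
    with Dominates-shrink u∈S u∉S′ S′⊆S front dom
  ... | R′ , |R′| , dom′ = record
    { matching = insertEdge matching uv u∉M v∉M
    ; within   = within′
    ; unique   = insertEdge-unique matching uv u∉M v∉M (λ w → isolated w ∘ within w) unique
    ; pairs    = suc pairs
    ; count≡   = trans (insertEdge-count matching uv u∉M v∉M) (cong (2 +_) count≡)
    ; bound    = +-cancelʳ-≤ (edges S′ + 3 * length O) _ _ bound′
    }
    where
    open Solution (solve R′ dom′)
    open ≤-Reasoning
    u∉M : ¬ u ∈ covered matching
    u∉M = u∉S′ ∘ within u
    v∉M : ¬ v ∈ covered matching
    v∉M = v∉S′ ∘ within v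
    within′ : covered (insertEdge matching uv u∉M v∉M) ⊆ S
    within′ i i∈ with insertEdge-covered matching uv u∉M v∉M i∈
    ... | inj₁ refl        = u∈S
    ... | inj₂ (inj₁ refl) = v∈S
    ... | inj₂ (inj₂ i∈M)  = S′⊆S i (within i i∈M)
    shuffle₁ : ∀ k e r f → (6 * k + e + 3 * r) + (f + 9) ≡ 6 * suc k + e + 3 * suc r + f
    shuffle₁ = solve-∀
    shuffle₂ : ∀ k e r o f → 6 * k + e + 3 * (r + o) + f ≡ (6 * k + f + 3 * r) + (e + 3 * o)
    shuffle₂ = solve-∀
    bound′ : 3 * count S + (edges S′ + 3 * length O)
             ≤ (6 * suc pairs + edges S + 3 * length R) + (edges S′ + 3 * length O)
    bound′ = begin
      3 * count S + (edges S′ + 3 * length O)                       ≤⟨ cost ⟩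
      3 * count S′ + (edges S + 9)                                  ≤⟨ +-monoˡ-≤ (edges S + 9) bound ⟩
      (6 * pairs + edges S′ + 3 * length R′) + (edges S + 9)        ≡⟨ shuffle₁ pairs (edges S′) (length R′) (edges S) ⟩
      6 * suc pairs + edges S′ + 3 * suc (length R′) + edges S
        ≡⟨ cong (λ r → 6 * suc pairs + edges S′ + 3 * r + edges S) |R′| ⟩
      6 * suc pairs + edges S′ + 3 * (length R + length O) + edges S
        ≡⟨ shuffle₂ (suc pairs) (edges S′) (length R) (length O) (edges S) ⟩
      (6 * suc pairs + edges S + 3 * length R) + (edges S′ + 3 * length O) ∎

  -- Reductions at vertices of degree 0, 1 and 2.

  module _ (subcubic : Subcubic G) {S : Fin n → Bool}
           (smaller : ∀ S′ → count S′ < count S → Solvable S′) where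

    private
      deg≤3 : ∀ v → deg S v ≤ 3
      deg≤3 v = ≤-trans (deg≤degree S v) (subcubic v)

    -- The new roots are the o other neighbours of `v`, and 1 + o edges disappear. The cost 6 + 3o ≤
    -- (1 + o) + 9 amounts to o ≤ 2, which is the degree bound at `v`.
    removeLeaf : ∀ {u} → u ∈ S → deg S u ≡ 1 → Solvable S
    removeLeaf {u} u∈S deg≡1 with count≡1⇒! (nbrs S u) deg≡1
    ... | v , v∈ , v! with ∈-nbrs⁻ v∈ | enumerate (nbrs (S ∖ u) v)
    ...   | v∈S , uv | O , |O| , O-all =
      matchEdge O (λ i → ∖-⊆ i ∘ ∖-⊆ i) u∈S v∈S (∉-∖ {S = S} ∘ ∖-⊆ u) (∉-∖ {S = S ∖ u}) uv
        isolated front cost (smaller (S ∖ u ∖ v) (<-trans (count-∖-< v∈S∖u) (count-∖-< u∈S)))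
      where
      v∈S∖u : v ∈ S ∖ u
      v∈S∖u = ∈-∖⁺ (adj-≢ uv ∘ sym) v∈S

      isolated : ∀ w → w ∈ S ∖ u ∖ v → ¬ adj G u w ≡ true
      isolated w w∈ uw = proj₁ (∈-∖⁻ w∈) (v! w (∈-nbrs⁺ (∖-⊆ w (∖-⊆ w w∈)) uw))

      front : Frontier S (S ∖ u ∖ v) O
      front {s} {t} s∈ t∈S t∉ st with t ≟ u
      ... | yes refl = ⊥-elim (isolated s s∈ (adj-sym st))
      ... | no  t≢u with ∖-removed (∈-∖⁺ t≢u t∈S) t∉
      ...   | refl = s , O-all s (∈-nbrs⁺ (∖-⊆ s s∈) (adj-sym st)) , stop s∈

      o≤2 : deg (S ∖ u) v ≤ 2
      o≤2 = ≤-pred (≤-trans (≤-reflexive (sym (deg-∖ u∈S (adj-sym uv)))) (deg≤3 v))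

      edges-lost : 1 + (deg (S ∖ u) v + edges (S ∖ u ∖ v)) ≤ edges S
      edges-lost = ≤-trans (+-mono-≤ (≤-reflexive (sym deg≡1)) (edges-∖ v∈S∖u)) (edges-∖ u∈S)

      cost : 3 * count S + (edges (S ∖ u ∖ v) + 3 * length O)
             ≤ 3 * count (S ∖ u ∖ v) + (edges S + 9)
      cost = begin
        3 * count S + (e + 3 * length O)
          ≡⟨ cong₂ (λ a o → 3 * a + (e + 3 * o))
               (trans (count-∖ S u∈S) (cong suc (count-∖ (S ∖ u) v∈S∖u))) |O| ⟩
        3 * (2 + c) + (e + 3 * o)              ≡⟨ shuffle₁ c e o ⟩
        3 * c + ((o + e) + (6 + (o + o)))      ≤⟨ +-monoʳ-≤ (3 * c) (+-monoʳ-≤ (o + e) (+-monoʳ-≤ 6 (+-mono-≤ o≤2 o≤2))) ⟩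
        3 * c + ((o + e) + 10)                 ≡⟨ shuffle₂ c e o ⟩
        3 * c + ((1 + (o + e)) + 9)            ≤⟨ +-monoʳ-≤ (3 * c) (+-monoˡ-≤ 9 edges-lost) ⟩
        3 * c + (edges S + 9)                  ∎
        where
        open ≤-Reasoning
        o = deg (S ∖ u) v
        c = count (S ∖ u ∖ v)
        e = edges (S ∖ u ∖ v)
        shuffle₁ : ∀ c e o → 3 * (2 + c) + (e + 3 * o) ≡ 3 * c + ((o + e) + (6 + (o + o)))
        shuffle₁ = solve-∀
        shuffle₂ : ∀ c e o → 3 * c + ((o + e) + 10) ≡ 3 * c + ((1 + (o + e)) + 9)
        shuffle₂ = solve-∀

    -- The component of `u` vanishes with it, so no new root is required.
    removeIsolated : ∀ {u} → u ∈ S → deg S u ≡ 0 → Solvable S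
    removeIsolated {u} u∈S deg≡0 =
      deleteVertex [] u∈S z≤n front (smaller (S ∖ u) (count-∖-< u∈S))
      where
      front : Frontier S (S ∖ u) []
      front {s} s∈ t∈S t∉ st with ∖-removed t∈S t∉
      ... | refl = ⊥-elim (count≡0⇒∅ deg≡0 s (∈-nbrs⁺ (∖-⊆ s s∈) (adj-sym st)))

    -- Three vertices and one new root cost 9 + 3. This is met by the 9 of `matchEdge` and three
    -- lost edges: the two at `u`, and vz. The vertex `z` may coincide with `w`.
    removeDegree2 : ∀ {u v w z} o → u ∈ S → deg S u ≡ 2 → v ∈ S → adj G u v ≡ true → w ∈ S → w ≢ v →
                    adj G u w ≡ true → (∀ t → t ∈ nbrs S u → t ≡ v ⊎ t ≡ w) →
                    z ∈ S → adj G v z ≡ true → z ≢ u →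
                    Frontier S (S ∖ u ∖ v ∖ w) (o ∷ []) → Solvable S
    removeDegree2 {u} {v} {w} {z} o u∈S deg≡2 v∈S uv w∈S w≢v uw v-or-w z∈S vz z≢u front =
      matchEdge (o ∷ []) S′⊆S u∈S v∈S (∉-∖ {S = S} ∘ ∖-⊆ u ∘ ∖-⊆ u) (∉-∖ {S = S ∖ u} ∘ ∖-⊆ v) uv
        isolated front cost
        (smaller S′ (<-trans (count-∖-< w∈₂) (<-trans (count-∖-< v∈₁) (count-∖-< u∈S))))
      where
      S′ : Fin n → Bool
      S′ = S ∖ u ∖ v ∖ w
      S′⊆S : S′ ⊆ S
      S′⊆S i = ∖-⊆ i ∘ ∖-⊆ i ∘ ∖-⊆ i
      v∈₁ : v ∈ S ∖ u
      v∈₁ = ∈-∖⁺ (adj-≢ uv ∘ sym) v∈S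
      w∈₂ : w ∈ S ∖ u ∖ v
      w∈₂ = ∈-∖⁺ w≢v (∈-∖⁺ (adj-≢ uw ∘ sym) w∈S)

      isolated : ∀ t → t ∈ S′ → ¬ adj G u t ≡ true
      isolated t t∈ ut with v-or-w t (∈-nbrs⁺ (S′⊆S t t∈) ut)
      ... | inj₁ refl = ∉-∖ {S = S ∖ u} (∖-⊆ t t∈)
      ... | inj₂ refl = ∉-∖ {S = S ∖ u ∖ v} t∈

      edges-lost : 3 + edges S′ ≤ edges S
      edges-lost = begin
        2 + (1 + edges S′)                               ≤⟨ +-monoʳ-≤ 2 (s≤s (≤-trans (m≤n+m _ _) (edges-∖ w∈₂))) ⟩
        2 + (1 + edges (S ∖ u ∖ v))                      ≤⟨ +-monoʳ-≤ 2 (+-monoˡ-≤ _ (count-pos (∈-nbrs⁺ (∈-∖⁺ z≢u z∈S) vz))) ⟩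
        2 + (deg (S ∖ u) v + edges (S ∖ u ∖ v))          ≤⟨ +-mono-≤ (≤-reflexive (sym deg≡2)) (edges-∖ v∈₁) ⟩
        deg S u + edges (S ∖ u)                          ≤⟨ edges-∖ u∈S ⟩
        edges S                                          ∎
        where open ≤-Reasoning

      cost : 3 * count S + (edges S′ + 3) ≤ 3 * count S′ + (edges S + 9)
      cost = begin
        3 * count S + (edges S′ + 3)
          ≡⟨ cong (λ a → 3 * a + (edges S′ + 3)) (trans (count-∖ S u∈S) (cong suc
               (trans (count-∖ (S ∖ u) v∈₁) (cong suc (count-∖ (S ∖ u ∖ v) w∈₂))))) ⟩
        3 * (3 + count S′) + (edges S′ + 3)      ≡⟨ shuffle (count S′) (edges S′) ⟩
        3 * count S′ + ((3 + edges S′) + 9)      ≤⟨ +-monoʳ-≤ (3 * count S′) (+-monoˡ-≤ 9 edges-lost) ⟩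
        3 * count S′ + (edges S + 9)             ∎
        where
        open ≤-Reasoning
        shuffle : ∀ c e → 3 * (3 + c) + (e + 3) ≡ 3 * c + ((3 + e) + 9)
        shuffle = solve-∀

    -- Minimum degree two: pieces without cut vertices.

    module _ (deg≥2 : ∀ v → v ∈ S → 2 ≤ deg S v) where

      -- The last hypothesis says that no vertex z of the component of y in G[S] − x is a cut
      -- vertex of G[S].
      solvePiece : ∀ {x y} → x ∈ S → y ∈ S → adj G x y ≡ true →
                   (∀ z w → Reach (S ∖ x) y z → adj G z w ≡ true → w ∈ S → Reach (S ∖ z) w x) →
                   Solvable S
      solvePiece {x} {y} x∈S y∈S xy noncut = from-y
        where
        piece⇒∈S : ∀ {z} → Reach (S ∖ x) y z → z ∈ S
        piece⇒∈S = ∖-⊆ _ ∘ target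

        -- Since `z` is not a cut vertex, all its neighbours still reach `x`: one new root suffices,
        -- paid by the three lost edges.
        remove3 : ∀ {z} → Reach (S ∖ x) y z → deg S z ≡ 3 → Solvable S
        remove3 {z} y→z deg≡3 =
          deleteVertex (x ∷ []) (piece⇒∈S y→z) (≤-reflexive (sym deg≡3)) front
            (smaller (S ∖ z) (count-∖-< (piece⇒∈S y→z)))
          where
          front : Frontier S (S ∖ z) (x ∷ [])
          front {s} s∈ t∈S t∉ st with ∖-removed t∈S t∉
          ... | refl = x , here refl , noncut z s y→z (adj-sym st) (∖-⊆ s s∈)

        -- In continuation form, because a vertex of degree 3 in the piece already settles `S`.
        degree2-or-solved : ∀ {z} → Reach (S ∖ x) y z → (deg S z ≡ 2 → Solvable S) → Solvable S
        degree2-or-solved {z} y→z solve with m≤n⇒m<n∨m≡n (deg≤3 z)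
        ... | inj₁ deg<3 = solve (≤-antisym (≤-pred deg<3) (deg≥2 z (piece⇒∈S y→z)))
        ... | inj₂ deg≡3 = remove3 y→z deg≡3

        y∈S∖x : y ∈ S ∖ x
        y∈S∖x = ∈-∖⁺ (adj-≢ xy ∘ sym) y∈S

        -- Only `x` links the triangle to the rest, and by at most one edge as its degree is at most
        -- 3. The far end of that edge is the one new root.
        triangle : ∀ {y₂} → deg S y ≡ 2 → y₂ ≢ x → y₂ ∈ S → adj G y y₂ ≡ true →
                   (∀ t → t ∈ nbrs S y → t ≡ x ⊎ t ≡ y₂) →
                   adj G y₂ x ≡ true → (∀ t → t ∈ nbrs S y₂ → t ≡ y ⊎ t ≡ x) → Solvable S
        triangle {y₂} degy y₂≢x y₂∈S yy₂ y-nbrs y₂x y₂-nbrs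
          -- The second `x` is a placeholder root for the case that `x` has no third neighbour.
          with count≤1⇒! (nbrs (S ∖ y ∖ y₂) x) x
                 (≤-pred (≤-pred (≤-trans (≤-reflexive (sym degx)) (deg≤3 x))))
          where
          degx : deg S x ≡ 2 + deg (S ∖ y ∖ y₂) x
          degx = trans (deg-∖ y∈S xy)
                   (cong suc (deg-∖ (∈-∖⁺ (adj-≢ yy₂ ∘ sym) y₂∈S) (adj-sym y₂x)))
        ... | o , o! = removeDegree2 o y∈S degy y₂∈S yy₂ x∈S (y₂≢x ∘ sym) (adj-sym xy)
                         (λ t → swap ∘ y-nbrs t) x∈S y₂x (adj-≢ xy) front
          where
          front : Frontier S (S ∖ y ∖ y₂ ∖ x) (o ∷ [])
          front {s} {t} s∈ t∈S t∉ st with t ≟ y | t ≟ y₂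
          ... | yes refl | _ with y-nbrs s (∈-nbrs⁺ (∖-⊆ s (∖-⊆ s (∖-⊆ s s∈))) (adj-sym st))
          ...   | inj₁ refl = ⊥-elim (∉-∖ {S = S ∖ y ∖ y₂} s∈)
          ...   | inj₂ refl = ⊥-elim (∉-∖ {S = S ∖ y} (∖-⊆ s s∈))
          front {s} {t} s∈ t∈S t∉ st | no _ | yes refl
            with y₂-nbrs s (∈-nbrs⁺ (∖-⊆ s (∖-⊆ s (∖-⊆ s s∈))) (adj-sym st))
          ...   | inj₁ refl = ⊥-elim (∉-∖ {S = S} (∖-⊆ s (∖-⊆ s s∈)))
          ...   | inj₂ refl = ⊥-elim (∉-∖ {S = S ∖ y ∖ y₂} s∈)
          front {s} {t} s∈ t∈S t∉ st | no t≢y | no t≢y₂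
            with ∖-removed (∈-∖⁺ t≢y₂ (∈-∖⁺ t≢y t∈S)) t∉
          ... | refl with o! s (∈-nbrs⁺ (∖-⊆ s s∈) (adj-sym st))
          ...   | refl = o , here refl , stop s∈

        -- The edge yx is the third lost edge. The vertex `x` serves as the only new root: it is the
        -- outer neighbour of `y`, and the neighbours of y₃ still reach it because y₃ is not a cut
        -- vertex.
        path : ∀ {y₂ y₃} → (∀ t → t ∈ nbrs S y → t ≡ x ⊎ t ≡ y₂) →
               deg S y₂ ≡ 2 → y₂ ≢ x → y₂ ∈ S → adj G y y₂ ≡ true →
               y₃ ∈ S → y₃ ≢ x → y₃ ≢ y → adj G y₂ y₃ ≡ true →
               (∀ t → t ∈ nbrs S y₂ → t ≡ y ⊎ t ≡ y₃) → Solvable S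
        path {y₂} {y₃} y-nbrs degy₂ y₂≢x y₂∈S yy₂ y₃∈S y₃≢x y₃≢y y₂y₃ y₂-nbrs =
          removeDegree2 x y₂∈S degy₂ y∈S (adj-sym yy₂) y₃∈S y₃≢y y₂y₃ y₂-nbrs
            x∈S (adj-sym xy) (y₂≢x ∘ sym) front
          where
          S′ : Fin n → Bool
          S′ = S ∖ y₂ ∖ y ∖ y₃
          S′⊆S : S′ ⊆ S
          S′⊆S i = ∖-⊆ i ∘ ∖-⊆ i ∘ ∖-⊆ i
          x∈S′ : x ∈ S′
          x∈S′ = ∈-∖⁺ (y₃≢x ∘ sym) (∈-∖⁺ (adj-≢ xy) (∈-∖⁺ (y₂≢x ∘ sym) x∈S))
          y→y₃ : Reach (S ∖ x) y y₃
          y→y₃ = step y∈S∖x yy₂ (step (∈-∖⁺ y₂≢x y₂∈S) y₂y₃ (stop (∈-∖⁺ y₃≢x y₃∈S)))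

          ¬adj-y₂ : ∀ {s} → s ∈ S′ → ¬ adj G s y₂ ≡ true
          ¬adj-y₂ {s} s∈ sy₂ with y₂-nbrs s (∈-nbrs⁺ (S′⊆S s s∈) (adj-sym sy₂))
          ... | inj₁ refl = ∉-∖ {S = S ∖ y₂} (∖-⊆ s s∈)
          ... | inj₂ refl = ∉-∖ {S = S ∖ y₂ ∖ y} s∈

          adj-y⇒x : ∀ {s} → s ∈ S′ → adj G s y ≡ true → s ≡ x
          adj-y⇒x {s} s∈ sy with y-nbrs s (∈-nbrs⁺ (S′⊆S s s∈) (adj-sym sy))
          ... | inj₁ s≡x  = s≡x
          ... | inj₂ refl = ⊥-elim (∉-∖ {S = S} (∖-⊆ s (∖-⊆ s s∈)))

          -- A path avoiding y₃ can enter {y, y₂} only from x.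
          reroute : ∀ {s} → s ∈ S′ → Reach (S ∖ y₃) s x → Reach S′ s x
          reroute s∈ (stop _) = stop s∈
          reroute {s} s∈ (step {w = w} _ sw p) with s ≟ x
          ... | yes refl = stop s∈
          ... | no  s≢x  = step s∈ sw (reroute w∈ p)
            where
            w∈ : w ∈ S′
            w∈ with ∈-∖⁻ (source p)
            ... | w≢y₃ , w∈S =
              ∈-∖⁺ w≢y₃ (∈-∖⁺ (λ { refl → s≢x (adj-y⇒x s∈ sw) })
                               (∈-∖⁺ (λ { refl → ¬adj-y₂ s∈ sw }) w∈S))

          front : Frontier S S′ (x ∷ [])
          front {s} {t} s∈ t∈S t∉ st with t ≟ y₂ | t ≟ y
          ... | yes refl | _ = ⊥-elim (¬adj-y₂ s∈ st)
          ... | no _ | yes refl with adj-y⇒x s∈ st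
          ...   | refl = s , here refl , stop s∈
          front {s} {t} s∈ t∈S t∉ st | no t≢y₂ | no t≢y
            with ∖-removed (∈-∖⁺ t≢y (∈-∖⁺ t≢y₂ t∈S)) t∉
          ... | refl = x , here refl , reroute s∈ (noncut t s y→y₃ (adj-sym st) (S′⊆S s s∈))

        from-y₂ : ∀ {y₂} → deg S y ≡ 2 → y₂ ≢ x → y₂ ∈ S → adj G y y₂ ≡ true →
                (∀ t → t ∈ nbrs S y → t ≡ x ⊎ t ≡ y₂) → deg S y₂ ≡ 2 → Solvable S
        from-y₂ {y₂} degy y₂≢x y₂∈S yy₂ y-nbrs degy₂
          with count≡2⇒other (nbrs S y₂) degy₂ (∈-nbrs⁺ y∈S (adj-sym yy₂))
        ... | y₃ , y₃≢y , y₃∈ , y₂-nbrs with ∈-nbrs⁻ y₃∈ | y₃ ≟ x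
        ...   | _ , y₂y₃ | yes refl = triangle degy y₂≢x y₂∈S yy₂ y-nbrs y₂y₃ y₂-nbrs
        ...   | y₃∈S , y₂y₃ | no y₃≢x =
          path y-nbrs degy₂ y₂≢x y₂∈S yy₂ y₃∈S y₃≢x y₃≢y y₂y₃ y₂-nbrs

        from-y : Solvable S
        from-y = degree2-or-solved (stop y∈S∖x) λ degy →
          let y₂ , y₂≢x , y₂∈ , y-nbrs = count≡2⇒other (nbrs S y) degy (∈-nbrs⁺ x∈S (adj-sym xy))
              y₂∈S , yy₂ = ∈-nbrs⁻ y₂∈
          in degree2-or-solved (step y∈S∖x yy₂ (stop (∈-∖⁺ y₂≢x y₂∈S)))
               (from-y₂ degy y₂≢x y₂∈S yy₂ y-nbrs)

      -- U contains the component of y in G[S] − x. If z is a cut vertex inside it, then a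
      -- component of G[S] − z avoiding x lies in U − z, and the search moves there.
      findPiece : ∀ k U → count U ≡ k → ∀ {x y} → x ∈ S → y ∈ S → adj G x y ≡ true →
                  (∀ s → Reach (S ∖ x) y s → s ∈ U) → Solvable S
      findPiece k U c≡ {x} {y} x∈S y∈S xy inU
        -- A cut vertex `z` is witnessed by a neighbour `w` that is separated from `x` once `z` is
        -- deleted.
        with any? (λ z → any? λ w → reach? (S ∖ x) y z ×-dec (adj G z w Bool.≟ true)
                                    ×-dec (w ∈? S) ×-dec ¬? (reach? (S ∖ z) w x))
      ... | no ∄cut = solvePiece x∈S y∈S xy λ z w y→z zw w∈S →
        decidable-stable (reach? (S ∖ z) w x) λ ¬w→x → ∄cut (z , w , y→z , zw , w∈S , ¬w→x)
      findPiece zero U c≡ x∈S y∈S xy inU | yes (z , _ , y→z , _) =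
        ⊥-elim (count≡0⇒∅ c≡ z (inU z y→z))
      findPiece (suc k) U c≡ {x} {y} x∈S y∈S xy inU | yes (z , w , y→z , zw , w∈S , ¬w→x) =
        -- Now `z` plays the role of `x` and `w` that of `y`. Whatever `w` reaches without `z` is
        -- reached without `x` too, hence from `y` through `z`, so it stays in `U`.
        findPiece k (U ∖ z) (suc-injective (trans (sym (count-∖ U (inU z y→z))) c≡))
          (∖-⊆ z (target y→z)) w∈S zw λ s w→s →
            ∈-∖⁺ (proj₁ (∈-∖⁻ (target w→s)))
              (inU s (Reach-trans y→z (step (target y→z) zw (Reach-mono swap∖ (avoid ¬w→x w→s)))))
        where
        swap∖ : S ∖ z ∖ x ⊆ S ∖ x
        swap∖ i i∈ = ∈-∖⁺ (proj₁ (∈-∖⁻ i∈)) (∖-⊆ i (∖-⊆ i i∈))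

    solveStep : Solvable S
    solveStep with any? (λ u → (u ∈? S) ×-dec (deg S u ≤? 1))
    ... | yes (u , u∈S , deg≤1) with m≤n⇒m<n∨m≡n deg≤1
    ...   | inj₁ deg<1 = removeIsolated u∈S (n<1⇒n≡0 deg<1)
    ...   | inj₂ deg≡1 = removeLeaf u∈S deg≡1
    solveStep | no ∄low with any? (_∈? S)
    ... | no S∅ = solveEmpty λ v v∈S → S∅ (v , v∈S)
    ... | yes (x , x∈S) with any? (_∈? nbrs S x)
    ...   | no none = ⊥-elim (∄low (x , x∈S , ≤-trans (≤-reflexive (count-∅ λ v v∈ → none (v , v∈))) z≤n))
    -- All degrees are at least 2 here; the search for a piece starts with `U` equal to `S`.
    ...   | yes (y , y∈) with ∈-nbrs⁻ y∈
    ...     | y∈S , xy = findPiece (λ v v∈S → ≰⇒> λ deg≤1 → ∄low (v , v∈S , deg≤1))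
                           (count S) S refl x∈S y∈S xy (λ s p → ∖-⊆ s (target p))

  -- The induction and the passage to the whole graph.

  solvable : Subcubic G → ∀ S → Solvable S
  solvable subcubic S = go (suc (count S)) S ≤-refl
    where
    go : ∀ k S → count S < k → Solvable S
    -- The bound `k` is strict, so k = 0 cannot occur.
    go (suc k) S c<k = solveStep subcubic λ S′ c′<c → go k S′ (<-≤-trans c′<c (≤-pred c<k))

  Connected⇒Reach : ∀ {u v} → Connected G u v → Reach (λ _ → true) u v
  Connected⇒Reach here        = stop ⟨ refl ⟩
  Connected⇒Reach (step uw p) = step ⟨ refl ⟩ uw (Connected⇒Reach p)

theorem2 : ∀ {n c : ℕ} (G : Graph n) → Subcubic G → HasComponents G c →
    ∃ λ (M : Matching G) → UniquelyRestricted M × (3 * n ≤ 6 * size M + edgeCount G + 3 * c)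
theorem2 {n} {c} G subcubic comps = matching , unique , (begin
  3 * n                                             ≡⟨ cong (3 *_) (count-all {n}) ⟨
  3 * count {n} (λ _ → true)                        ≤⟨ bound ⟩
  6 * pairs + edges G (λ _ → true) + 3 * length R   ≡⟨ cong₂ (λ e r → 6 * pairs + e + 3 * r) (edges-all G) (length-tabulate rep) ⟩
  6 * pairs + edgeCount G + 3 * c                   ≡⟨ cong (λ k → 6 * k + edgeCount G + 3 * c) size≡ ⟨
  6 * size matching + edgeCount G + 3 * c           ∎)
  where
  open HasComponents comps
  open ≤-Reasoning
  -- One representative per component gives a dominating list of length exactly `c`.
  rep : Fin c → Fin n
  rep k = proj₁ (surjective k)
  R : List (Fin n)
  R = tabulate rep
  dominates : Dominates G (λ _ → true) R
  dominates s _ = rep (comp s) , ∈-tabulate⁺ (comp s) ,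
    Connected⇒Reach G (sound s _ (sym (proj₂ (surjective (comp s)))))
  open Solution (solvable G subcubic (λ _ → true) R dominates)
  -- The covered count is an explicit multiple of 2, so halving it loses nothing.
  size≡ : size matching ≡ pairs
  size≡ = trans (cong (_/ 2) count≡) (m*n/n≡m pairs 2)
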